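{- If $n$ is a positive integer with $n\leq 10^{14}$ and $\phi(n)=\frac{2}{3}(n+1)$, where $\phi$ is Euler's totient function, then $n\in\{5,\ 35,\ 1295,\ 1679615\}$.
   Context: Here $35=5\cdot7$, $1295=5\cdot7\cdot37$, $1679615=5\cdot7\cdot37\cdot1297$ are the previously known solutions. -}

module Defs where

open import Data.Nat using (ℕ; suc; _≟_)
open import Data.Nat.GCD using (gcd)
open import Data.List using (List; length; filter)
open import Data.List using (upTo)
open import Data.List using (map)
open import Relation.Nullary.Decidable using (⌊_⌋)

φ : ℕ → ℕ
φ n = length (filter (λ k → gcd k n ≟ 1) (map suc (upTo n)))

{-# OPTIONS --safe #-}
module Submission where

open import Defs
open import Data.Nat
open import Data.Nat.Properties
open import Data.Nat.Coprimality using (Coprime; coprime-divisor; coprime⇒gcd≡1; gcd≡1⇒coprime)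
open import Data.Nat.DivMod hiding (_mod_; _div_)
open import Data.Nat.Divisibility
open import Data.Nat.GCD using (gcd)
open import Data.Nat.Induction using (<-rec)
open import Data.Nat.ListAction using (product)
open import Data.Nat.ListAction.Properties using (product-↭)
open import Data.Nat.Primality
open import Data.Nat.Primality.Factorisation
  using (PrimeFactorisation; factorise; factorisationHasAllPrimeFactors)
open import Data.Nat.Solver using (module +-*-Solver)
open import Data.Bool using (Bool; true; false; if_then_else_; _∧_; _∨_; T)
open import Data.Bool.ListAction using (all; any)
open import Data.Bool.Properties using (T-≡; T-∧; T-∨)
open import Data.List using (List; []; _∷_; applyUpTo; filter; length; map; upTo)
open import Data.List.Properties using (length-filter; length-map; length-upTo; map-upTo)
open import Data.List.Relation.Binary.Permutation.Propositional using (↭-sym)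
open import Data.List.Relation.Binary.Permutation.Propositional.Properties using (All-resp-↭)
open import Data.List.Relation.Unary.All as All using (All; []; _∷_)
open import Data.List.Relation.Unary.All.Properties using (all⁻)
open import Data.List.Relation.Unary.AllPairs as AllPairs using (AllPairs; []; _∷_)
open import Data.List.Relation.Unary.Any using (here; there)
open import Data.List.Relation.Unary.Any.Properties using (any⁻)
open import Data.List.Relation.Unary.Sorted.TotalOrder.Properties using (Sorted⇒AllPairs)
open import Data.List.Sort ≤-decTotalOrder using (sort; sort-↭; sort-↗)
open import Data.Product using (_×_; _,_; proj₁; proj₂; ∃-syntax)
open import Data.Sum using (_⊎_; inj₁; inj₂; [_,_]′)
open import Function using (_∘_; Equivalence)
open import Relation.Nullary using (Dec; yes; no; does; ¬_; contradiction)
open import Relation.Nullary.Decidable using (from-no; from-yes)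
open import Relation.Unary using (Decidable)
open import Relation.Binary.PropositionalEquality
open Equivalence using (to; from)

-- A solution n is squarefree and coprime to 6, and no prime factor of n divides q − 1 for another
-- prime factor q: otherwise that prime would divide φ(n) and n, hence 2. Its primes can therefore be
-- found by a depth-first search. After choosing primes with product P, put a = 3 φ(P) and b = 2 P;
-- the product m of the remaining r primes must satisfy a φ(m) = b m + 2. If p is the least of them,
-- then a / (a − b) < p (as φ(m) ≤ m) and, by Bernoulli's inequality φ(m)/m ≥ 1 − r/p,
-- (a − b) p ≤ 2 + r a. For n ≤ 10¹⁴ these windows leave well under a million candidates, and the last
-- prime is determined by (a − b) p = 2 + a.

private variable P Q : Set

-- Finite sums over initial segments.

∑ : (ℕ → ℕ) → ℕ → ℕ
∑ f zero    = 0
∑ f (suc n) = f 0 + ∑ (f ∘ suc) n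

∑-cong : ∀ {f g} → (∀ i → f i ≡ g i) → ∀ n → ∑ f n ≡ ∑ g n
∑-cong eq zero    = refl
∑-cong eq (suc n) = cong₂ _+_ (eq 0) (∑-cong (eq ∘ suc) n)

∑-zero : ∀ f n → (∀ {i} → i < n → f i ≡ 0) → ∑ f n ≡ 0
∑-zero f zero    eq = refl
∑-zero f (suc n) eq = cong₂ _+_ (eq z<s) (∑-zero (f ∘ suc) n (eq ∘ s<s))

∑-+ : ∀ f g n → ∑ (λ i → f i + g i) n ≡ ∑ f n + ∑ g n
∑-+ f g zero    = refl
∑-+ f g (suc n) = begin
  f 0 + g 0 + ∑ (λ i → f (suc i) + g (suc i)) n      ≡⟨ cong (f 0 + g 0 +_) (∑-+ (f ∘ suc) (g ∘ suc) n) ⟩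
  f 0 + g 0 + (∑ (f ∘ suc) n + ∑ (g ∘ suc) n)        ≡⟨ interchange (f 0) (g 0) _ _ ⟩
  (f 0 + ∑ (f ∘ suc) n) + (g 0 + ∑ (g ∘ suc) n)      ∎
  where
  open ≡-Reasoning
  open +-*-Solver
  interchange : ∀ a b c d → a + b + (c + d) ≡ (a + c) + (b + d)
  interchange = solve 4 (λ a b c d → a :+ b :+ (c :+ d) := (a :+ c) :+ (b :+ d)) refl

∑-split : ∀ f m n → ∑ f (m + n) ≡ ∑ f m + ∑ (λ i → f (m + i)) n
∑-split f zero    n = refl
∑-split f (suc m) n = trans (cong (f 0 +_) (∑-split (f ∘ suc) m n)) (sym (+-assoc (f 0) _ _))

∑-last : ∀ f n → ∑ f (suc n) ≡ ∑ f n + f n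
∑-last f n = begin
  ∑ f (suc n)            ≡⟨ cong (∑ f) (+-comm 1 n) ⟩
  ∑ f (n + 1)            ≡⟨ ∑-split f n 1 ⟩
  ∑ f n + (f (n + 0) + 0) ≡⟨ cong (∑ f n +_) (trans (+-identityʳ _) (cong f (+-identityʳ n))) ⟩
  ∑ f n + f n            ∎
  where open ≡-Reasoning

∑-periodic : ∀ f m → (∀ i → f (m + i) ≡ f i) → ∀ k → ∑ f (k * m) ≡ k * ∑ f m
∑-periodic f m eq zero    = refl
∑-periodic f m eq (suc k) = trans (∑-split f m (k * m))
  (cong (∑ f m +_) (trans (∑-cong eq (k * m)) (∑-periodic f m eq k)))

-- Cut the range into blocks of length `p`. Only the first index of a block is a multiple of `p`,
-- and shifting `f` by `p` preserves the vanishing hypothesis.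
∑-multiples : ∀ f p .{{_ : NonZero p}} → (∀ i → p ∤ i → f i ≡ 0) →
              ∀ m → ∑ f (m * p) ≡ ∑ (λ j → f (j * p)) m
∑-multiples f p@(suc p-1) vanish zero    = refl
∑-multiples f p@(suc p-1) vanish (suc m) = begin
  ∑ f (p + m * p)                      ≡⟨ ∑-split f p (m * p) ⟩
  ∑ f p + ∑ (λ i → f (p + i)) (m * p)  ≡⟨ cong₂ _+_ first rest ⟩
  f 0 + ∑ (λ j → f (p + j * p)) m      ∎
  where
  open ≡-Reasoning
  first : ∑ f p ≡ f 0
  first = trans (cong (f 0 +_) (∑-zero (f ∘ suc) p-1 λ i<p-1 → vanish _ λ p∣ → <⇒≱ (s<s i<p-1) (∣⇒≤ p∣)))
                (+-identityʳ (f 0))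
  rest : ∑ (λ i → f (p + i)) (m * p) ≡ ∑ (λ j → f (p + j * p)) m
  rest = ∑-multiples (λ i → f (p + i)) p (λ i p∤i → vanish (p + i) λ p∣p+i → p∤i (∣m+n∣m⇒∣n p∣p+i ∣-refl)) m

-- Indicators and counting.

indicator : Dec P → ℕ
indicator P? = if does P? then 1 else 0

indicator-cong : (P? : Dec P) (Q? : Dec Q) → (P → Q) → (Q → P) → indicator P? ≡ indicator Q?
indicator-cong (yes _) (yes _) _ _ = refl
indicator-cong (no  _) (no  _) _ _ = refl
indicator-cong (yes p) (no ¬q) f _ = contradiction (f p) ¬q
indicator-cong (no ¬p) (yes q) _ g = contradiction (g q) ¬p

indicator-no : (P? : Dec P) → ¬ P → indicator P? ≡ 0
indicator-no (no  _) _  = refl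
indicator-no (yes p) ¬p = contradiction p ¬p

indicator-yes : (P? : Dec P) → P → indicator P? ≡ 1
indicator-yes (yes _) _ = refl
indicator-yes (no ¬p) p = contradiction p ¬p

length-filter-applyUpTo : ∀ {P : ℕ → Set} (P? : Decidable P) f n →
  length (filter P? (applyUpTo f n)) ≡ ∑ (λ i → indicator (P? (f i))) n
length-filter-applyUpTo P? f zero = refl
length-filter-applyUpTo P? f (suc n) with does (P? (f 0))
... | true  = cong suc (length-filter-applyUpTo P? (f ∘ suc) n)
... | false = length-filter-applyUpTo P? (f ∘ suc) n

-- Euler's totient and multiplication by a prime.

coprime# : ℕ → ℕ → ℕ
coprime# n i = indicator (gcd i n ≟ 1)

coprime#-cong : ∀ m n i j → (Coprime i m → Coprime j n) → (Coprime j n → Coprime i m) →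
                coprime# m i ≡ coprime# n j
coprime#-cong m n i j f g = indicator-cong (gcd i m ≟ 1) (gcd j n ≟ 1)
  (λ eq → coprime⇒gcd≡1 (f (gcd≡1⇒coprime eq))) (λ eq → coprime⇒gcd≡1 (g (gcd≡1⇒coprime eq)))

-- φ counts 1..n; counting 0..n-1 gives the same since gcd(0,n) = gcd(n,n).
φ≡∑coprime# : ∀ n → φ n ≡ ∑ (coprime# n) n
φ≡∑coprime# n = +-cancelˡ-≡ (coprime# n 0) _ _ (begin
  coprime# n 0 + φ n                    ≡⟨ cong (coprime# n 0 +_) counted ⟩
  coprime# n 0 + ∑ (coprime# n ∘ suc) n ≡⟨ ∑-last (coprime# n) n ⟩
  ∑ (coprime# n) n + coprime# n n       ≡⟨ +-comm (∑ (coprime# n) n) _ ⟩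
  coprime# n n + ∑ (coprime# n) n       ≡⟨ cong (_+ ∑ (coprime# n) n) n≈0 ⟩
  coprime# n 0 + ∑ (coprime# n) n       ∎)
  where
  open ≡-Reasoning
  counted : φ n ≡ ∑ (coprime# n ∘ suc) n
  counted = trans (cong (length ∘ filter (λ k → gcd k n ≟ 1)) (map-upTo suc n))
                  (length-filter-applyUpTo (λ k → gcd k n ≟ 1) suc n)
  n≈0 : coprime# n n ≡ coprime# n 0
  n≈0 = coprime#-cong n n n 0 (λ c (_ , d∣n) → c (d∣n , d∣n)) (λ c (_ , d∣n) → c (_ ∣0 , d∣n))

-- Adding `m` to `i` does not change gcd(i, m), so the range consists of `k` full periods.
∑coprime#-multiple : ∀ m k → ∑ (coprime# m) (k * m) ≡ k * φ m
∑coprime#-multiple m k = trans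
  (∑-periodic (coprime# m) m (λ i → coprime#-cong m m (m + i) i
     (λ c (d∣i , d∣m) → c (∣m∣n⇒∣m+n d∣m d∣i , d∣m))
     (λ c (d∣m+i , d∣m) → c (∣m+n∣m⇒∣n d∣m+i d∣m , d∣m))) k)
  (cong (k *_) (sym (φ≡∑coprime# m)))

prime-∤⇒coprime : ∀ {p i} → Prime p → p ∤ i → Coprime i p
prime-∤⇒coprime p-prime p∤i (d∣i , d∣p) with prime⇒irreducible p-prime d∣p
... | inj₁ d≡1  = d≡1
... | inj₂ refl = contradiction d∣i p∤i

coprime-* : ∀ {i m n} → Coprime i m → Coprime i n → Coprime i (m * n)
coprime-* {m = m} c c′ (d∣i , d∣mn) =
  c′ (d∣i , coprime-divisor {n = m} (λ (e∣d , e∣m) → c (∣-trans e∣d d∣i , e∣m)) d∣mn)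

-- Since `p ∣ m`, coprimality to `p * m` and to `m` coincide, and the range below `p * m` is `p`
-- periods of the latter.
φ-*-prime-∣ : ∀ {p m} → Prime p → p ∣ m → φ (p * m) ≡ p * φ m
φ-*-prime-∣ {p} {m} p-prime p∣m = begin
  φ (p * m)                      ≡⟨ φ≡∑coprime# (p * m) ⟩
  ∑ (coprime# (p * m)) (p * m)   ≡⟨ ∑-cong (λ i → coprime#-cong (p * m) m i i drop add) (p * m) ⟩
  ∑ (coprime# m) (p * m)         ≡⟨ ∑coprime#-multiple m p ⟩
  p * φ m                        ∎
  where
  open ≡-Reasoning
  drop : ∀ {i} → Coprime i (p * m) → Coprime i m
  drop c (d∣i , d∣m) = c (d∣i , ∣n⇒∣m*n p d∣m)
  add : ∀ {i} → Coprime i m → Coprime i (p * m)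
  add c = coprime-* (λ (d∣i , d∣p) → c (d∣i , ∣-trans d∣p p∣m)) c

-- Of the `p * φ m` indices below `p * m` that are coprime to `m`, exactly `φ m` are multiples of
-- `p`; the others are those coprime to `p * m`.
φ-*-prime-∤ : ∀ {p m} → Prime p → p ∤ m → φ (p * m) ≡ pred p * φ m
-- Adding `φ m` on both sides avoids subtraction: with `p = suc p-1`, the product `p * φ m` unfolds
-- to `φ m + p-1 * φ m`.
φ-*-prime-∤ {p@(suc p-1)} {m} p-prime p∤m = +-cancelˡ-≡ (φ m) _ _ (begin
  φ m + φ (p * m)                                          ≡⟨ +-comm (φ m) _ ⟩
  φ (p * m) + φ m                                          ≡⟨ cong₂ _+_ (φ≡∑coprime# (p * m)) (sym multiples) ⟩
  ∑ (coprime# (p * m)) (p * m) + ∑ divisible (p * m)       ≡⟨ ∑-+ (coprime# (p * m)) divisible (p * m) ⟨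
  ∑ (λ i → coprime# (p * m) i + divisible i) (p * m)       ≡⟨ ∑-cong split (p * m) ⟩
  ∑ (coprime# m) (p * m)                                   ≡⟨ ∑coprime#-multiple m p ⟩
  φ m + p-1 * φ m                                          ∎)
  where
  open ≡-Reasoning
  divisible : ℕ → ℕ
  divisible i = indicator (p ∣? i) * coprime# m i

  divisible-∤ : ∀ i → p ∤ i → divisible i ≡ 0
  divisible-∤ i p∤i = cong (_* coprime# m i) (indicator-no (p ∣? i) p∤i)

  divisible-∣ : ∀ i → p ∣ i → divisible i ≡ coprime# m i
  divisible-∣ i p∣i = trans (cong (_* coprime# m i) (indicator-yes (p ∣? i) p∣i)) (*-identityˡ _)

  -- As `p ∤ m`, the factor `p` does not affect coprimality to `m`.
  at-multiple : ∀ j → divisible (j * p) ≡ coprime# m j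
  at-multiple j = trans (divisible-∣ (j * p) (n∣m*n j)) (coprime#-cong m m (j * p) j
    (λ c (d∣j , d∣m) → c (∣m⇒∣m*n p d∣j , d∣m))
    (λ c (d∣jp , d∣m) → coprime-* (λ (e∣m , e∣j) → c (e∣j , e∣m)) (prime-∤⇒coprime p-prime p∤m) (d∣m , d∣jp)))

  multiples : ∑ divisible (p * m) ≡ φ m
  multiples = begin
    ∑ divisible (p * m)             ≡⟨ cong (∑ divisible) (*-comm p m) ⟩
    ∑ divisible (m * p)             ≡⟨ ∑-multiples divisible p divisible-∤ m ⟩
    ∑ (λ j → divisible (j * p)) m   ≡⟨ ∑-cong at-multiple m ⟩
    ∑ (coprime# m) m                ≡⟨ φ≡∑coprime# m ⟨
    φ m                             ∎

  split : ∀ i → coprime# (p * m) i + divisible i ≡ coprime# m i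
  split i with p ∣? i
  ... | yes p∣i = cong₂ _+_ (indicator-no (gcd i (p * m) ≟ 1)
          λ eq → contradiction (subst Prime (gcd≡1⇒coprime eq (p∣i , m∣m*n m)) p-prime) ¬prime[1])
          (divisible-∣ i p∣i)
  ... | no  p∤i = trans (cong₂ _+_ (coprime#-cong (p * m) m i i
          (λ c (d∣i , d∣m) → c (d∣i , ∣n⇒∣m*n p d∣m))
          (coprime-* (prime-∤⇒coprime p-prime p∤i))) (divisible-∤ i p∤i)) (+-identityʳ _)

φ≤ : ∀ n → φ n ≤ n
φ≤ n = ≤-trans (length-filter (λ k → gcd k n ≟ 1) (map suc (upTo n)))
  (≤-reflexive (trans (length-map suc (upTo n)) (length-upTo n)))

-- Strong induction: for odd `m` the factor 2 leaves the totient unchanged, and for `m = 2 * l` it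
-- doubles `φ (2 * l)`, which is at most `l` by induction.
φ-even-≤ : ∀ m → φ (2 * m) ≤ m
φ-even-≤ = <-rec (λ m → φ (2 * m) ≤ m) step
  where
  step : ∀ m → (∀ {l} → l < m → φ (2 * l) ≤ l) → φ (2 * m) ≤ m
  step m rec with 2 ∣? m
  ... | no 2∤m = begin
    φ (2 * m)  ≡⟨ φ-*-prime-∤ prime[2] 2∤m ⟩
    1 * φ m    ≡⟨ *-identityˡ (φ m) ⟩
    φ m        ≤⟨ φ≤ m ⟩
    m          ∎
    where open ≤-Reasoning
  ... | yes (divides zero refl) = z≤n
  ... | yes 2∣m@(divides l@(suc _) m≡l*2) = begin
    φ (2 * m)        ≡⟨ φ-*-prime-∣ prime[2] 2∣m ⟩
    2 * φ m          ≡⟨ cong (λ k → 2 * φ k) m≡2*l ⟩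
    2 * φ (2 * l)    ≤⟨ *-monoʳ-≤ 2 (rec l<m) ⟩
    2 * l            ≡⟨ m≡2*l ⟨
    m                ∎
    where
    open ≤-Reasoning
    m≡2*l : m ≡ 2 * l
    m≡2*l = trans m≡l*2 (*-comm l 2)
    l<m : l < m
    l<m = subst (l <_) (sym m≡l*2) (m<m*n l 2 (s<s z<s))

-- Remainders and residue classes.

infixl 7 _mod_ _div_

-- Total, so that the search below can divide without evidence that the divisor a ∸ b is nonzero.
_mod_ _div_ : ℕ → ℕ → ℕ
m mod zero      = m
m mod d@(suc _) = m % d
m div zero      = 0
m div d@(suc _) = m / d

m≡m-mod-d+[m-div-d]*d : ∀ m d → m ≡ m mod d + (m div d) * d
m≡m-mod-d+[m-div-d]*d m zero      = sym (+-identityʳ m)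
m≡m-mod-d+[m-div-d]*d m d@(suc _) = m≡m%n+[m/n]*n m d

mod≡0⇒∣ : ∀ m d → m mod d ≡ 0 → d ∣ m
mod≡0⇒∣ m d eq = divides (m div d) (trans (m≡m-mod-d+[m-div-d]*d m d) (cong (_+ m div d * d) eq))

mod≡1⇒∣pred : ∀ m d → m mod d ≡ 1 → d ∣ pred m
mod≡1⇒∣pred m d eq =
  divides (m div d) (cong pred (trans (m≡m-mod-d+[m-div-d]*d m d) (cong (_+ m div d * d) eq)))

-- Remainder 0 would give `d ∣ m` and remainder 1 would give `d ∣ pred m`, so the search can test
-- both exclusions by a single comparison.
1<mod : ∀ {m d} → d ∤ m → d ∤ pred m → 1 < m mod d
1<mod {m} {d} d∤m d∤pred with m mod d in eq
... | 0           = contradiction (mod≡0⇒∣ m d eq) d∤m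
... | 1           = contradiction (mod≡1⇒∣pred m d eq) d∤pred
... | suc (suc _) = s<s z<s

%6≡1⊎5 : ∀ {m} → 2 ∤ m → 3 ∤ m → m % 6 ≡ 1 ⊎ m % 6 ≡ 5
%6≡1⊎5 {m} 2∤m 3∤m with m % 6 in eq | m%n<n m 6
... | 1 | _ = inj₁ refl
... | 5 | _ = inj₂ refl
... | 0 | _ = contradiction (∣-trans (divides 3 refl) (m%n≡0⇒n∣m m 6 eq)) 2∤m
... | 2 | _ = contradiction (∣n∣m%n⇒∣m (divides 3 refl) (subst (2 ∣_) (sym eq) (divides 1 refl))) 2∤m
... | 3 | _ = contradiction (∣n∣m%n⇒∣m (divides 2 refl) (subst (3 ∣_) (sym eq) (divides 1 refl))) 3∤m
... | 4 | _ = contradiction (∣n∣m%n⇒∣m (divides 3 refl) (subst (2 ∣_) (sym eq) (divides 2 refl))) 2∤m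
... | suc (suc (suc (suc (suc (suc _))))) | s≤s (s≤s (s≤s (s≤s (s≤s (s≤s ())))))

-- Products of distinct primes.

totient : List ℕ → ℕ
totient ps = product (map pred ps)

φ-product : ∀ {ps} → All Prime ps → AllPairs _≢_ ps → φ (product ps) ≡ totient ps
φ-product []                 []             = refl
φ-product {p ∷ _} (p-prime ∷ primes) (p∉ps ∷ ps≢) = trans
  (φ-*-prime-∤ p-prime λ p∣ps → All.lookup p∉ps (factorisationHasAllPrimeFactors p-prime p∣ps primes) refl)
  (cong (pred p *_) (φ-product primes ps≢))

all-∣product : ∀ ps → All (_∣ product ps) ps
all-∣product []       = []
all-∣product (p ∷ ps) = m∣m*n (product ps) ∷ All.map (∣n⇒∣m*n p) (all-∣product ps)

-- Recording the product of two entries, not each entry separately, makes a repeated prime visible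
-- as a square divisor.
pairs-∣product : ∀ ps → AllPairs (λ p q → p * q ∣ product ps) ps
pairs-∣product []       = []
pairs-∣product (p ∷ ps) =
  All.map (*-monoʳ-∣ p) (all-∣product ps) ∷ AllPairs.map (∣n⇒∣m*n p) (pairs-∣product ps)

-- Constraints on the prime factors of a solution.

infix 4 _≺_
_≺_ : ℕ → ℕ → Set
q ≺ p = q < p × 1 < p mod q

record Candidate (p : ℕ) : Set where
  field
    isPrime : Prime p
    4<      : 4 < p
    mod6    : p % 6 ≡ 1 ⊎ p % 6 ≡ 5

module Solution {n : ℕ} (eq : 3 * φ n ≡ 2 * (n + 1)) where

  -- The equation reads `3 * φ n ≡ 2 * n + 2`, which modulo `d` leaves only the 2. Taking `d = 3`
  -- excludes 3, and a prime above 4 cannot divide both `n` and `φ n`.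
  ∣n⇒∣3φ⇒∣2 : ∀ {d} → d ∣ n → d ∣ 3 * φ n → d ∣ 2
  ∣n⇒∣3φ⇒∣2 {d} d∣n d∣3φ =
    ∣m+n∣m⇒∣n {m = 2 * n} (subst (d ∣_) (trans eq (*-distribˡ-+ 2 n 1)) d∣3φ) (∣n⇒∣m*n 2 d∣n)

  -- An even `n` has totient at most n/2, and 3n/2 is below 2(n + 1).
  2∤n : 2 ∤ n
  2∤n (divides m refl) = <⇒≱ 3φ<2[n+1] (≤-reflexive (sym eq))
    where
    open ≤-Reasoning
    3φ<2[n+1] : 3 * φ (m * 2) < 2 * (m * 2 + 1)
    3φ<2[n+1] = begin-strict
      3 * φ (m * 2)     ≡⟨ cong (λ k → 3 * φ k) (*-comm m 2) ⟩
      3 * φ (2 * m)     ≤⟨ *-monoʳ-≤ 3 (φ-even-≤ m) ⟩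
      3 * m             ≤⟨ *-monoˡ-≤ m (n≤1+n 3) ⟩
      4 * m             <⟨ m<m+n (4 * m) (z<s {1}) ⟩
      4 * m + 2         ≡⟨ solve 1 (λ m → con 4 :* m :+ con 2 := con 2 :* (m :* con 2 :+ con 1)) refl m ⟩
      2 * (m * 2 + 1)   ∎
      where open +-*-Solver

  3∤n : 3 ∤ n
  3∤n 3∣n = contradiction (∣n⇒∣3φ⇒∣2 3∣n (m∣m*n (φ n))) (from-no (3 ∣? 2))

  prime∣n⇒4< : ∀ {p} → Prime p → p ∣ n → 4 < p
  prime∣n⇒4< {0} p-prime _   = contradiction p-prime ¬prime[0]
  prime∣n⇒4< {1} p-prime _   = contradiction p-prime ¬prime[1]
  prime∣n⇒4< {2} _       p∣n = contradiction p∣n 2∤n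
  prime∣n⇒4< {3} _       p∣n = contradiction p∣n 3∤n
  prime∣n⇒4< {4} _       p∣n = contradiction (∣-trans (divides 2 refl) p∣n) 2∤n
  prime∣n⇒4< {suc (suc (suc (suc (suc _))))} _ _ = s≤s (s≤s (s≤s (s≤s (s≤s z≤n))))

  candidate : ∀ {p} → Prime p → p ∣ n → Candidate p
  candidate p-prime p∣n = record
    { isPrime = p-prime
    ; 4<      = prime∣n⇒4< p-prime p∣n
    ; mod6    = %6≡1⊎5 (λ 2∣p → 2∤n (∣-trans 2∣p p∣n)) (λ 3∣p → 3∤n (∣-trans 3∣p p∣n))
    }

  prime∣n⇒∤φ : ∀ {p} → Prime p → p ∣ n → p ∤ φ n
  prime∣n⇒∤φ p-prime p∣n p∣φ = <⇒≱ (prime∣n⇒4< p-prime p∣n)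
    (≤-trans (∣⇒≤ (∣n⇒∣3φ⇒∣2 p∣n (∣n⇒∣m*n 3 p∣φ))) (s≤s (s≤s z≤n)))

  -- A repeated prime survives in the totient, since `p ∣ m` gives `φ (p * m) ≡ p * φ m`.
  square-free : ∀ {p} m → Prime p → n ≡ p * m → p ∤ m
  square-free m p-prime n≡pm p∣m = prime∣n⇒∤φ p-prime (subst (_ ∣_) (sym n≡pm) (m∣m*n m))
    (subst (_ ∣_) (sym (trans (cong φ n≡pm) (φ-*-prime-∣ p-prime p∣m))) (m∣m*n (φ m)))

  -- With `p * q ∣ n`, equality of `p` and `q` would give a square divisor. If `p` divided `pred q`,
  -- it would divide `φ n`, which has the factor `pred q`.
  prime-pair-≺ : ∀ {p q} → Prime p → Prime q → p ≤ q → p * q ∣ n → p ≺ q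
  prime-pair-≺ {p} {q} p-prime q-prime p≤q pq∣n@(divides k n≡k*pq) = ≤∧≢⇒< p≤q p≢q , 1<mod p∤q p∤pred-q
    where
    p∣n : p ∣ n
    p∣n = ∣-trans (m∣m*n q) pq∣n

    n≡q*kp : n ≡ q * (k * p)
    n≡q*kp = trans n≡k*pq (solve 3 (λ k p q → k :* (p :* q) := q :* (k :* p)) refl k p q)
      where open +-*-Solver

    p≢q : p ≢ q
    p≢q refl = square-free (k * p) p-prime n≡q*kp (n∣m*n k)

    p∤q : p ∤ q
    p∤q p∣q with prime⇒irreducible q-prime p∣q
    ... | inj₁ refl = ¬prime[1] p-prime
    ... | inj₂ p≡q  = p≢q p≡q

    p∤pred-q : p ∤ pred q
    p∤pred-q p∣pred-q = prime∣n⇒∤φ p-prime p∣n (subst (p ∣_) (sym φn≡) (∣m⇒∣m*n (φ (k * p)) p∣pred-q))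
      where
      φn≡ : φ n ≡ pred q * φ (k * p)
      φn≡ = trans (cong φ n≡q*kp) (φ-*-prime-∤ q-prime (square-free (k * p) q-prime n≡q*kp))

  sorted-factors : .{{NonZero n}} →
    ∃[ ps ] product ps ≡ n × totient ps ≡ φ n × All Candidate ps × AllPairs _≺_ ps
  sorted-factors = ps , product≡n , sym φn≡ , candidates , pairs
    where
    open PrimeFactorisation (factorise n) using (factors; isFactorisation; factorsPrime)
    ps : List ℕ
    ps = sort factors

    product≡n : product ps ≡ n
    product≡n = trans (product-↭ (sort-↭ factors)) (sym isFactorisation)

    primes : All Prime ps
    primes = All-resp-↭ (↭-sym (sort-↭ factors)) factorsPrime

    candidates : All Candidate ps
    candidates = All.zipWith (λ (p-prime , p∣) → candidate p-prime (subst (_ ∣_) product≡n p∣))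
                             (primes , all-∣product ps)

    combine : ∀ {xs} → All Prime xs → AllPairs _≤_ xs → AllPairs (λ p q → p * q ∣ product ps) xs →
              AllPairs _≺_ xs
    combine []                 []             []           = []
    combine (x-prime ∷ primes) (x≤ ∷ sorted) (x∣ ∷ pairs) =
      All.zipWith (λ (y-prime , x≤y , xy∣) → prime-pair-≺ x-prime y-prime x≤y (subst (_ ∣_) product≡n xy∣))
                  (primes , All.zip (x≤ , x∣))
      ∷ combine primes sorted pairs

    pairs : AllPairs _≺_ ps
    pairs = combine primes (Sorted⇒AllPairs ≤-totalOrder (sort-↗ factors)) (pairs-∣product ps)

    φn≡ : φ n ≡ totient ps
    φn≡ = trans (cong φ (sym product≡n)) (φ-product primes (AllPairs.map (<⇒≢ ∘ proj₁) pairs))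

-- Boolean tests used by the search.

-- Running out of fuel counts as failure, so the length of a search window needs no proved bound.
everyFrom : (stop test : ℕ → Bool) (fuel j : ℕ) → Bool
everyFrom stop test zero       j = false
everyFrom stop test (suc fuel) j = stop j ∨ (test j ∧ everyFrom stop test fuel (suc j))

-- While `stop` is false, a successful run must test the current index and go on, so it reaches `k`.
everyFrom-sound : ∀ stop test fuel {j k} → T (everyFrom stop test fuel j) → j ≤ k →
                  (∀ {i} → i ≤ k → ¬ T (stop i)) → T (test k)
everyFrom-sound stop test (suc fuel) {j} {k} every j≤k ¬stop with to T-∨ every
... | inj₁ stops = contradiction stops (¬stop j≤k)
... | inj₂ rest with to T-∧ rest | m≤n⇒m<n∨m≡n j≤k
...   | now , _     | inj₂ refl = now
...   | _   , later | inj₁ j<k  = everyFrom-sound stop test fuel later j<k ¬stop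

infixr 3 _⇒ᵇ_
-- The conclusion is evaluated only under a true premise, which prunes the search tree.
_⇒ᵇ_ : Bool → Bool → Bool
x ⇒ᵇ y = if x then y else true

⇒ᵇ-elim : ∀ {x y} → T (x ⇒ᵇ y) → T x → T y
⇒ᵇ-elim {true} y _ = y

-- The primes from 5 to 31; 2 and 3 are left to the residues modulo 6.
trialDivisors : List ℕ
trialDivisors = 5 ∷ 7 ∷ 11 ∷ 13 ∷ 17 ∷ 19 ∷ 23 ∷ 29 ∷ 31 ∷ []

passesTrialDivision : ℕ → Bool
passesTrialDivision p = all (λ d → (p ≡ᵇ d) ∨ (0 <ᵇ p mod d)) trialDivisors

prime⇒passesTrialDivision : ∀ {p} → Prime p → T (passesTrialDivision p)
prime⇒passesTrialDivision {p} p-prime =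
  all⁻ _ (All.map undivided (from-yes (All.all? (1 <?_) trialDivisors)))
  where
  undivided : ∀ {d} → 1 < d → T ((p ≡ᵇ d) ∨ (0 <ᵇ p mod d))
  undivided {d} 1<d with p mod d in eq
  ... | suc _ = from (T-∨ {p ≡ᵇ d}) (inj₂ _)
  ... | zero with prime⇒irreducible p-prime (mod≡0⇒∣ p d eq)
  ...   | inj₁ refl = contradiction 1<d (<-irrefl refl)
  ...   | inj₂ d≡p  = from T-∨ (inj₁ (≡⇒≡ᵇ p d (sym d≡p)))

-- Necessary conditions on the next prime. Composites may pass; they cost time but do not affect
-- soundness.
admissible : List ℕ → ℕ → ℕ → Bool
admissible qs q p = (q <ᵇ p) ∧ (all (λ q′ → 1 <ᵇ p mod q′) qs ∧ passesTrialDivision p)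

-- Doubled because the search carries b = 2P.
doubles : List ℕ
doubles = 2 * 5 ∷ 2 * 35 ∷ 2 * 1295 ∷ 2 * 1679615 ∷ []

known : ℕ → Bool
known b = any (b ≡ᵇ_) doubles

Search : Set
Search = (b a : ℕ) (qs : List ℕ) (q : ℕ) → Bool

-- With one prime left the equation is linear and gives `p * (a ∸ b) ≡ 2 + a`. If `a ≤ b`, then
-- `(2 + a) mod 0` is the nonzero `2 + a`, and the leaf succeeds because no such prime exists.
leaf : Search
leaf b a qs q = (2 + a) mod (a ∸ b) ≡ᵇ 0 ⇒ᵇ admissible qs q p ⇒ᵇ known (b * p)
  where
  p : ℕ
  p = (2 + a) div (a ∸ b)

-- Bounds on the least remaining prime.

-- Bernoulli's inequality cleared of denominators. A new factor `x = suc y` splits `p * (x * m)`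
-- into `p * m`, bounded by `p ≤ x`, and `y * (p * m)`, bounded by induction.
bernoulli : ∀ {p} ps → All (p ≤_) ps →
            p * product ps ≤ p * totient ps + length ps * product ps
bernoulli {p} []           []           = m≤m+n (p * 1) 0
bernoulli {p} (zero ∷ ps)  (z≤n ∷ _)    = z≤n
bernoulli {p} (x@(suc y) ∷ ps) (p≤x ∷ p≤ps) = begin
  p * (x * m)                             ≡⟨ solve 3 (λ p y m → p :* ((con 1 :+ y) :* m) := p :* m :+ y :* (p :* m)) refl p y m ⟩
  p * m + y * (p * m)                     ≤⟨ +-mono-≤ (*-monoˡ-≤ m p≤x) (*-monoʳ-≤ y (bernoulli ps p≤ps)) ⟩
  x * m + y * (p * f + r * m)             ≡⟨ cong (x * m +_) (*-distribˡ-+ y (p * f) (r * m)) ⟩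
  x * m + (y * (p * f) + y * (r * m))     ≤⟨ +-monoʳ-≤ (x * m) (+-monoʳ-≤ (y * (p * f)) (*-monoˡ-≤ (r * m) (n≤1+n y))) ⟩
  x * m + (y * (p * f) + x * (r * m))     ≡⟨ solve 6 (λ p x y m f r →
                                               x :* m :+ (y :* (p :* f) :+ x :* (r :* m)) :=
                                               p :* (y :* f) :+ (con 1 :+ r) :* (x :* m)) refl p x y m f r ⟩
  p * (y * f) + suc r * (x * m)           ∎
  where
  open ≤-Reasoning
  open +-*-Solver
  m = product ps
  f = totient ps
  r = length ps

totient≤product : ∀ ps → totient ps ≤ product ps
totient≤product []       = ≤-refl
totient≤product (p ∷ ps) = *-mono-≤ (pred[n]≤n {p}) (totient≤product ps)

^length≤product : ∀ {p} ps → All (p ≤_) ps → p ^ length ps ≤ product ps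
^length≤product []       []           = ≤-refl
^length≤product (x ∷ ps) (p≤x ∷ p≤ps) = *-mono-≤ p≤x (^length≤product ps p≤ps)

-- Multiply the Bernoulli bound by `a`, replace `a * f` by `b * m + 2`, absorb the resulting `2 * p`
-- into `2 * m`, and cancel `m`.
gap-upper : ∀ {a b p f r} m .{{_ : NonZero m}} → a * f ≡ b * m + 2 → p * m ≤ p * f + r * m → p ≤ m →
            (a ∸ b) * p ≤ 2 + r * a
gap-upper {a} {b} {p} {f} {r} m eq pm≤ p≤m = begin
  (a ∸ b) * p        ≡⟨ *-distribʳ-∸ p a b ⟩
  a * p ∸ b * p      ≤⟨ m≤n+o⇒m∸n≤o (a * p) (b * p) (*-cancelʳ-≤ (a * p) (b * p + (2 + r * a)) m scaled) ⟩
  2 + r * a          ∎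
  where
  open ≤-Reasoning
  open +-*-Solver
  scaled : a * p * m ≤ (b * p + (2 + r * a)) * m
  scaled = begin
    a * p * m                        ≡⟨ *-assoc a p m ⟩
    a * (p * m)                      ≤⟨ *-monoʳ-≤ a pm≤ ⟩
    a * (p * f + r * m)              ≡⟨ solve 5 (λ a p f r m → a :* (p :* f :+ r :* m) := p :* (a :* f) :+ a :* (r :* m)) refl a p f r m ⟩
    p * (a * f) + a * (r * m)        ≡⟨ cong (λ x → p * x + a * (r * m)) eq ⟩
    p * (b * m + 2) + a * (r * m)    ≡⟨ solve 5 (λ a b p r m → p :* (b :* m :+ con 2) :+ a :* (r :* m) :=
                                          p :* con 2 :+ (b :* p :* m :+ a :* (r :* m))) refl a b p r m ⟩
    p * 2 + (b * p * m + a * (r * m)) ≤⟨ +-monoˡ-≤ _ (*-monoˡ-≤ 2 p≤m) ⟩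
    m * 2 + (b * p * m + a * (r * m)) ≡⟨ solve 5 (λ a b p r m → m :* con 2 :+ (b :* p :* m :+ a :* (r :* m)) :=
                                          (b :* p :+ (con 2 :+ r :* a)) :* m) refl a b p r m ⟩
    (b * p + (2 + r * a)) * m        ∎

-- From `f ≤ m` the equation gives `b * p * f < a * pred p * f`; cancelling `f` leaves
-- `b * p < a * pred p`.
gap-lower : ∀ {a b f m} p → a * (pred p * f) ≡ b * (p * m) + 2 → f ≤ m → a < (a ∸ b) * p
gap-lower {a} {b} {f} {m} zero eq _ = contradiction (trans (sym (*-zeroʳ a)) (trans eq (+-comm (b * 0) 2))) λ ()
gap-lower {a} {b} {f} {m} p@(suc y) eq f≤m = begin
  suc a              ≤⟨ m+n≤o⇒m≤o∸n (suc a) a+bp<ap ⟩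
  a * p ∸ b * p      ≡⟨ *-distribʳ-∸ p a b ⟨
  (a ∸ b) * p        ∎
  where
  open ≤-Reasoning
  bp<ay : b * p < a * y
  bp<ay = *-cancelʳ-< f (b * p) (a * y) (begin-strict
    b * p * f          ≤⟨ *-monoʳ-≤ (b * p) f≤m ⟩
    b * p * m          ≡⟨ *-assoc b p m ⟩
    b * (p * m)        <⟨ m<m+n (b * (p * m)) (z<s {1}) ⟩
    b * (p * m) + 2    ≡⟨ eq ⟨
    a * (y * f)        ≡⟨ *-assoc a y f ⟨
    a * y * f          ∎)
  a+bp<ap : a + b * p < a * p
  a+bp<ap = begin-strict
    a + b * p          <⟨ +-monoʳ-< a bp<ay ⟩
    a + a * y          ≡⟨ *-suc a y ⟨
    a * p              ∎

last-factor : ∀ {a b} p .{{_ : NonZero p}} → a * pred p ≡ b * p + 2 → p * (a ∸ b) ≡ 2 + a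
last-factor {a} {b} p@(suc y) eq = begin
  p * (a ∸ b)               ≡⟨ *-comm p (a ∸ b) ⟩
  (a ∸ b) * p               ≡⟨ *-distribʳ-∸ p a b ⟩
  a * p ∸ b * p             ≡⟨ cong (_∸ b * p) (trans (*-suc a y) (cong (a +_) eq)) ⟩
  a + (b * p + 2) ∸ b * p   ≡⟨ cong (_∸ b * p) (solve 2 (λ a bp → a :+ (bp :+ con 2) := con 2 :+ a :+ bp) refl a (b * p)) ⟩
  2 + a + b * p ∸ b * p     ≡⟨ m+n∸n≡m (2 + a) (b * p) ⟩
  2 + a                     ∎
  where
  open ≡-Reasoning
  open +-*-Solver

m*n-mod-n≡0 : ∀ m n → m * n mod n ≡ 0
m*n-mod-n≡0 m zero      = *-zeroʳ m
m*n-mod-n≡0 m n@(suc _) = m*n%n≡0 m n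

m*n-div-n≡m : ∀ m n .{{_ : NonZero n}} → m * n div n ≡ m
m*n-div-n≡m m n@(suc _) = m*n/n≡m m n

m<n*o⇒m-div-n≤o : ∀ {m} n {o} → m < n * o → m div n ≤ o
m<n*o⇒m-div-n≤o {m} n@(suc _) {o} m<no = <⇒≤ (m<n*o⇒m/o<n {m} {o} (subst (m <_) (*-comm n o) m<no))

admissible-sound : ∀ {qs q p} → q < p → All (_≺ p) qs → Prime p → T (admissible qs q p)
admissible-sound q<p qs≺p p-prime = from T-∧ (<⇒<ᵇ q<p ,
  from T-∧ (all⁻ _ (All.map (<⇒<ᵇ ∘ proj₂) qs≺p) , prime⇒passesTrialDivision p-prime))

-- The depth-first search and its soundness.

module Bounded (limit fuel : ℕ) where

  module Branching (continue : Search) (r b a : ℕ) (qs : List ℕ) (q : ℕ) where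

    child test stop : ℕ → Bool
    child p = admissible qs q p ⇒ᵇ continue (b * p) (a * pred p) (p ∷ qs) p
    test j = child (1 + 6 * j) ∧ child (5 + 6 * j)
    -- The first clause violates the Bernoulli bound on the least prime. The second says that `r`
    -- primes of size at least `6 * j` would push the product past the limit.
    stop j = (2 + r * a <ᵇ (a ∸ b) * (6 * j)) ∨ (2 * limit <ᵇ b * (6 * j) ^ r)

    branch : Bool
    -- The next prime exceeds both `q` and a / (a - b); rounding down to a block of six keeps its
    -- block in range.
    branch = everyFrom stop test fuel ((q ⊔ a div (a ∸ b)) / 6)

  search : ℕ → Search
  search 0                   b a qs q = known b
  search 1                   b a qs q = leaf b a qs q
  search r@(suc r-1@(suc _)) b a qs q = Branching.branch (search r-1) r b a qs q

  -- The totient equation for n = P * product ps, with b = 2P and a = 3 φ(P), where qs lists the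
  -- primes of P and q is the largest of them (initially 4, which every prime factor exceeds).
  record Completion (b a : ℕ) (qs : List ℕ) (q : ℕ) (ps : List ℕ) : Set where
    constructor completion
    field
      candidates : All Candidate ps
      increasing : AllPairs _≺_ ps
      beyond     : All (λ p → q < p × All (_≺ p) qs) ps
      equation   : a * totient ps ≡ b * product ps + 2
      bounded    : b * product ps ≤ 2 * limit

  leaf-sound : ∀ {b a qs q p} → Completion b a qs q (p ∷ []) → T (leaf b a qs q) → T (known (b * p))
  leaf-sound {b} {a} {qs} {q} {p}
    (completion (p-cand ∷ []) _ ((q<p , qs≺p) ∷ []) equation _) checked =
    subst (λ x → T (admissible qs q x ⇒ᵇ known (b * x)) → T (known (b * p))) (sym p≡)
      (λ checked′ → ⇒ᵇ-elim checked′ (admissible-sound {qs} q<p qs≺p isPrime))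
      (⇒ᵇ-elim checked (≡⇒≡ᵇ ((2 + a) mod (a ∸ b)) 0 mod≡0))
    where
    open Candidate p-cand
    instance
      p≢0 : NonZero p
      p≢0 = prime⇒nonZero isPrime
    factored : p * (a ∸ b) ≡ 2 + a
    factored = last-factor {a} {b} p (trans (cong (a *_) (sym (*-identityʳ (pred p))))
                                      (trans equation (cong (λ x → b * x + 2) (*-identityʳ p))))
    mod≡0 : (2 + a) mod (a ∸ b) ≡ 0
    mod≡0 = subst (λ x → x mod (a ∸ b) ≡ 0) factored (m*n-mod-n≡0 p (a ∸ b))
    p≡ : (2 + a) div (a ∸ b) ≡ p
    p≡ with a ∸ b | factored
    ... | zero      | p*0≡2+a = contradiction (trans (sym (*-zeroʳ p)) p*0≡2+a) λ ()
    ... | d@(suc _) | p*d≡2+a = subst (λ x → x div d ≡ p) p*d≡2+a (m*n-div-n≡m p d)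

  -- The least remaining prime `p` lies in the tested window: `gap-lower` puts `p / 6` at or after
  -- the start, and `gap-upper` with the size bound keeps `stop` false up to it. Hence `p` was
  -- tried, and induction continues with `p` moved into P.
  search-sound : ∀ {b a qs q} ps → Completion b a qs q ps → T (search (length ps) b a qs q) →
                 T (known (b * product ps))
  search-sound {b} [] _ checked = subst (T ∘ known) (sym (*-identityʳ b)) checked
  search-sound {b} (p ∷ []) c checked =
    subst (λ x → T (known (b * x))) (sym (*-identityʳ p)) (leaf-sound c checked)
  search-sound {b} {a} {qs} {q} (p ∷ ps@(_ ∷ _))
    (completion candidates@(p-cand ∷ ps-cand) (p≺ps ∷ increasing)
                ((q<p , qs≺p) ∷ beyond) equation bounded) checked =
    subst (T ∘ known) (*-assoc b p (product ps))
      (search-sound ps rest (⇒ᵇ-elim {admissible qs q p} at-p (admissible-sound {qs} q<p qs≺p isPrime)))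
    where
    open Candidate p-cand
    r = length (p ∷ ps)
    open Branching (search (length ps)) r b a qs q

    p≤ : All (p ≤_) (p ∷ ps)
    p≤ = ≤-refl ∷ All.map (<⇒≤ ∘ proj₁) p≺ps

    instance
      product≢0 : NonZero (product (p ∷ ps))
      product≢0 = productOfPrimes≢0 (All.map Candidate.isPrime candidates)

    start≤ : (q ⊔ a div (a ∸ b)) / 6 ≤ p / 6
    start≤ = /-monoˡ-≤ 6 (⊔-lub (<⇒≤ q<p) (m<n*o⇒m-div-n≤o (a ∸ b)
      (gap-lower {a} {b} p equation (totient≤product ps))))

    proceed : ∀ {j} → j ≤ p / 6 → ¬ T (stop j)
    proceed {j} j≤p/6 = [ (λ t → <⇒≱ (<ᵇ⇒< (2 + r * a) ((a ∸ b) * (6 * j)) t) small-gap)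
                         , (λ t → <⇒≱ (<ᵇ⇒< (2 * limit) (b * (6 * j) ^ r) t) small-product) ]′
                        ∘ to (T-∨ {2 + r * a <ᵇ (a ∸ b) * (6 * j)} {2 * limit <ᵇ b * (6 * j) ^ r})
      where
      open ≤-Reasoning
      6j≤p : 6 * j ≤ p
      6j≤p = begin
        6 * j         ≤⟨ *-monoʳ-≤ 6 j≤p/6 ⟩
        6 * (p / 6)   ≡⟨ *-comm 6 (p / 6) ⟩
        p / 6 * 6     ≤⟨ m/n*n≤m p 6 ⟩
        p             ∎
      small-gap : (a ∸ b) * (6 * j) ≤ 2 + r * a
      small-gap = begin
        (a ∸ b) * (6 * j) ≤⟨ *-monoʳ-≤ (a ∸ b) 6j≤p ⟩
        (a ∸ b) * p       ≤⟨ gap-upper {a} {b} {p} {r = r} (product (p ∷ ps)) equation (bernoulli (p ∷ ps) p≤)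
                               (∣⇒≤ (m∣m*n (product ps))) ⟩
        2 + r * a         ∎
      small-product : b * (6 * j) ^ r ≤ 2 * limit
      small-product = begin
        b * (6 * j) ^ r      ≤⟨ *-monoʳ-≤ b (^-monoˡ-≤ r 6j≤p) ⟩
        b * p ^ r            ≤⟨ *-monoʳ-≤ b (^length≤product (p ∷ ps) p≤) ⟩
        b * product (p ∷ ps) ≤⟨ bounded ⟩
        2 * limit            ∎

    p≡ : ∀ {c} → p % 6 ≡ c → c + 6 * (p / 6) ≡ p
    p≡ {c} p%6≡c = sym (trans (m≡m%n+[m/n]*n p 6) (cong₂ _+_ p%6≡c (*-comm (p / 6) 6)))

    both : T (test (p / 6))
    both = everyFrom-sound stop test fuel checked start≤ proceed

    at-p : T (child p)
    at-p = [ (λ eq → subst (T ∘ child) (p≡ eq) (proj₁ (to T-∧ both)))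
           , (λ eq → subst (T ∘ child) (p≡ eq) (proj₂ (to T-∧ both))) ]′ mod6

    rest : Completion (b * p) (a * pred p) (p ∷ qs) p ps
    rest = completion ps-cand increasing
      (All.zipWith (λ (p≺x , (_ , qs≺x)) → proj₁ p≺x , p≺x ∷ qs≺x) (p≺ps , beyond))
      (trans (*-assoc a (pred p) _) (trans equation (cong (_+ 2) (sym (*-assoc b p _)))))
      (subst (_≤ 2 * limit) (sym (*-assoc b p _)) bounded)

  searchUpTo : ℕ → Bool
  searchUpTo zero    = true
  -- The search starts from P = 1, hence b = 2 and a = 3.
  searchUpTo (suc r) = search (suc r) 2 3 [] 4 ∧ searchUpTo r

  searchUpTo-lookup : ∀ R {r} → T (searchUpTo R) → r < R → T (search (suc r) 2 3 [] 4)
  searchUpTo-lookup (suc R) {r} succeeds r<1+R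
    with to (T-∧ {search (suc R) 2 3 [] 4}) succeeds | m<1+n⇒m<n∨m≡n r<1+R
  ... | now , _     | inj₂ refl = now
  ... | _   , later | inj₁ r<R  = searchUpTo-lookup R later r<R

  -- All prime factors are at least 5, so `limit < 5 ^ suc R` leaves room for at most `R` of them.
  solution-known : ∀ {n} R → n ≤ limit → limit < 5 ^ suc R → searchUpTo R ≡ true → .{{NonZero n}} →
                   3 * φ n ≡ 2 * (n + 1) → T (known (2 * n))
  solution-known {n} R n≤limit limit<5^1+R succeeds eq with Solution.sorted-factors eq
  -- No prime factors means n = 1, where the equation would read 3 = 4.
  ... | []     , refl , _ , _ , _ = contradiction eq λ ()
  ... | p ∷ ps , refl , totient≡φ , candidates , increasing =
    search-sound (p ∷ ps) (completion candidates increasing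
        (All.map (λ c → Candidate.4< c , []) candidates)
        (trans (cong (3 *_) totient≡φ) (trans eq (*-distribˡ-+ 2 n 1)))
        (*-monoʳ-≤ 2 n≤limit))
      (searchUpTo-lookup R {length ps} (from T-≡ succeeds)
        (≰⇒> λ R≤ → <⇒≱ 5^length<5^1+R (^-monoʳ-≤ 5 (s≤s R≤))))
    where
    5^length<5^1+R : 5 ^ length (p ∷ ps) < 5 ^ suc R
    5^length<5^1+R = ≤-<-trans (^length≤product (p ∷ ps) (All.map Candidate.4< candidates))
                               (≤-<-trans n≤limit limit<5^1+R)

-- The run of the search for the limit 10¹⁴.

halve : ∀ {n} k → T (2 * n ≡ᵇ 2 * k) → n ≡ k
halve {n} k t = *-cancelˡ-≡ n k 2 (≡ᵇ⇒≡ (2 * n) (2 * k) t)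

known-sound : ∀ n → T (known (2 * n)) → n ≡ 5 ⊎ n ≡ 35 ⊎ n ≡ 1295 ⊎ n ≡ 1679615
known-sound n is-known with any⁻ (2 * n ≡ᵇ_) doubles is-known
... | here eq                         = inj₁ (halve 5 eq)
... | there (here eq)                 = inj₂ (inj₁ (halve 35 eq))
... | there (there (here eq))         = inj₂ (inj₂ (inj₁ (halve 1295 eq)))
... | there (there (there (here eq))) = inj₂ (inj₂ (inj₂ (halve 1679615 eq)))

-- Stated with _≡ true, as comparing two types of the form T (searchUpTo …) would run the search again.
search-succeeds : Bounded.searchUpTo (10 ^ 14) 10000 20 ≡ true
search-succeeds = refl

theorem13 : (n : ℕ) → 0 < n → n ≤ 10 ^ 14 → 3 * φ n ≡ 2 * (n + 1) →
    n ≡ 5 ⊎ n ≡ 35 ⊎ n ≡ 1295 ⊎ n ≡ 1679615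
theorem13 n 0<n n≤10^14 eq = known-sound n
  -- Since 5²⁰ < 10¹⁴ < 5²¹, the bound of 20 primes is the least this estimate allows.
  (Bounded.solution-known (10 ^ 14) 10000 20 n≤10^14 (<ᵇ⇒< (10 ^ 14) (5 ^ 21) _) search-succeeds
    {{>-nonZero 0<n}} eq)
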